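{- For any graft $(G,T)$, the binary relation $\sim_{(G,T)}$ on $V(G)$ is an equivalence relation on $V(G)$.
   Context: Graphs are finite and undirected; $V(G)$ and $E(G)$ denote the vertex and edge sets of $G$. For $v\in V(G)$, $\delta_G(v)$ is the set of edges joining $v$ and $V(G)\setminus\{v\}$. $A\triangle B$ denotes the symmetric difference $(A\setminus B)\cup(B\setminus A)$. Graft: a pair $(G,T)$ of a graph $G$ and a set $T\subseteq V(G)$ such that each connected component of $G$ contains an even number of vertices from $T$. A join of $(G,T)$ is a set $F\subseteq E(G)$ such that $|\delta_G(v)\cap F|$ is odd for each $v\in T$ and even for each $v\in V(G)\setminus T$ (every graft has a join). A minimum join is a join with the minimum number of edges, and $\nu(G,T)$ denotes the number of edges of a minimum join of $(G,T)$. An edge $e\in E(G)$ is allowed in $(G,T)$ if some minimum join of $(G,T)$ contains $e$. A path is a connected graph in which every vertex has degree at most two and at least one vertex has degree less than two (a single vertex is a path). Vertices $u,v\in V(G)$ are factor-connected in $(G,T)$ if there is a path between $u$ and $v$ in $G$ all of whose edges are allowed. Definition of the relation: for $u,v\in V(G)$, $u\sim_{(G,T)}v$ if either $u=v$, or $u$ and $v$ are distinct factor-connected vertices with $\nu(G,T\triangle\{u,v\})=\nu(G,T)$. -}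

module Defs where

open import Data.Fin.Base using (Fin)
open import Data.Fin.Properties using (_≟_; all?)
open import Data.Fin.Subset
  using (Subset; inside; outside; _∈_; _∉_; _∩_; _∪_; _─_; ∣_∣; ⁅_⁆; ⊤; Nonempty)
open import Data.Fin.Subset.Properties using (_∈?_; ∣p∣≤n)
open import Data.List.Base using (List; []; _∷_; map; _++_; filter; foldr)
open import Data.List.Membership.Propositional using () renaming (_∈_ to _∈ₗ_)
open import Data.List.Membership.Propositional.Properties
  using (∈-map⁺; ∈-map⁻; ∈-++⁺ˡ; ∈-++⁺ʳ; ∈-filter⁺; ∈-filter⁻)
open import Data.List.Relation.Unary.Any using (here; there)
open import Data.Nat.Base using (ℕ; zero; suc; _+_; _≤_; _<_; _⊓_)
open import Data.Nat.Divisibility using (_∣_; _∣?_)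
open import Data.Nat.Properties
  using (≤-trans; ≤-antisym; m⊓n≤m; m⊓n≤n; ⊓-glb)
open import Data.Product.Base using (_×_; _,_; proj₁; proj₂; ∃)
open import Data.Sum.Base using (_⊎_)
open import Data.Vec.Base using ([]; _∷_; tabulate)
open import Function.Base using (_∘_)
open import Function.Bundles using (_⇔_)
open import Level using (0ℓ)
open import Relation.Binary.Construct.Closure.ReflexiveTransitive using (Star)
open import Relation.Binary.PropositionalEquality
  using (_≡_; _≢_; refl)
open import Relation.Nullary using (¬_)
open import Relation.Nullary.Decidable using (does; ¬?; _×-dec_; _⊎-dec_; _→-dec_)
open import Relation.Unary using (Pred; Decidable)

-- Loops and parallel edges are allowed.  The order of the two ends of an edge
-- carries no meaning: everything below is symmetric in src and tgt.
record Graph : Set where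
  field
    order : ℕ
    size  : ℕ
    ends  : Fin size → Fin order × Fin order

  Vertex Edge : Set
  Vertex = Fin order
  Edge   = Fin size

  src tgt : Edge → Vertex
  src = proj₁ ∘ ends
  tgt = proj₂ ∘ ends

comprehension : ∀ {n} {P : Pred (Fin n) 0ℓ} → Decidable P → Subset n
comprehension P? = tabulate (does ∘ P?)

infixl 6 _△_
_△_ : ∀ {n} → Subset n → Subset n → Subset n
A △ B = (A ─ B) ∪ (B ─ A)

allSubsets : ∀ n → List (Subset n)
allSubsets zero    = [] ∷ []
allSubsets (suc n) = map (inside ∷_) (allSubsets n) ++ map (outside ∷_) (allSubsets n)

module _ (G : Graph) where
  open Graph G

  Joins : Edge → Vertex → Vertex → Set
  Joins e x y = (src e ≡ x × tgt e ≡ y) ⊎ (src e ≡ y × tgt e ≡ x)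

  Step : Subset size → Vertex → Vertex → Set
  Step F x y = ∃ λ e → e ∈ F × Joins e x y

  IsComponent : Subset order → Set
  IsComponent C = ∃ λ v → ∀ w → w ∈ C ⇔ Star (Step ⊤) v w

  -- Loops at v are not in δ v.
  δ : Vertex → Subset size
  δ v = comprehension λ e →
    ((src e ≟ v) ×-dec ¬? (tgt e ≟ v)) ⊎-dec ((tgt e ≟ v) ×-dec ¬? (src e ≟ v))

  IsJoin : Subset order → Subset size → Set
  IsJoin T F = ∀ v → (v ∈ T → ¬ (2 ∣ ∣ δ v ∩ F ∣)) × (v ∉ T → 2 ∣ ∣ δ v ∩ F ∣)

  isJoin? : ∀ T → Decidable (IsJoin T)
  isJoin? T F = all? λ v →
    ((v ∈? T) →-dec ¬? (2 ∣? ∣ δ v ∩ F ∣)) ×-dec (¬? (v ∈? T) →-dec (2 ∣? ∣ δ v ∩ F ∣))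

  IsMinimumJoin : Subset order → Subset size → Set
  IsMinimumJoin T F = IsJoin T F × (∀ F′ → IsJoin T F′ → ∣ F ∣ ≤ ∣ F′ ∣)

  -- The number of edges of a minimum join (see ν-minimum).  A join has at most
  -- size edges, so starting the minimum from size is harmless; if T has no
  -- join at all, i.e. (G , T) is not a graft, then ν T is the junk value size.
  ν : Subset order → ℕ
  ν T = foldr _⊓_ size (map ∣_∣ (filter (isJoin? T) (allSubsets size)))

  record Subgraph : Set where
    field
      vertices : Subset order
      edges    : Subset size
      closed   : ∀ e → e ∈ edges → src e ∈ vertices × tgt e ∈ vertices

  open Subgraph

  Connected : Subgraph → Set
  Connected H = Nonempty (vertices H)
              × (∀ x y → x ∈ vertices H → y ∈ vertices H → Star (Step (edges H)) x y)

  -- A loop contributes two to the degree of its vertex.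
  degree : Subgraph → Vertex → ℕ
  degree H v = ∣ comprehension (λ e → src e ≟ v) ∩ edges H ∣
             + ∣ comprehension (λ e → tgt e ≟ v) ∩ edges H ∣

  IsPath : Subgraph → Set
  IsPath P = Connected P
           × (∀ v → v ∈ vertices P → degree P v ≤ 2)
           × (∃ λ v → v ∈ vertices P × degree P v < 2)

  -- The ends of a path are its vertices of degree less than two: two vertices
  -- of degree one, or the only vertex of a one-vertex path (then u ≡ v).
  IsPathBetween : Subgraph → Vertex → Vertex → Set
  IsPathBetween P u v =
      IsPath P × (∀ x → (x ∈ vertices P × degree P x < 2) ⇔ (x ≡ u ⊎ x ≡ v))

record Graft : Set where
  field
    graph     : Graph
  open Graph graph public
  field
    terminals : Subset order
    even      : ∀ C → IsComponent graph C → 2 ∣ ∣ C ∩ terminals ∣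

module _ (Γ : Graft) where
  open Graft Γ renaming (graph to G; terminals to T)

  Allowed : Edge → Set
  Allowed e = ∃ λ F → IsMinimumJoin G T F × e ∈ F

  FactorConnected : Vertex → Vertex → Set
  FactorConnected u v = ∃ λ (P : Subgraph G) →
    IsPathBetween G P u v × (∀ e → e ∈ Subgraph.edges P → Allowed e)

  -- For u, v in the same component of G, (G , T △ {u, v}) is again a graft, so
  -- both values of ν are genuine.
  Similar : Vertex → Vertex → Set
  Similar u v = u ≡ v
    ⊎ (u ≢ v × FactorConnected u v × ν G (T △ (⁅ u ⁆ ∪ ⁅ v ⁆)) ≡ ν G T)

∈-allSubsets : ∀ {n} (p : Subset n) → p ∈ₗ allSubsets n
∈-allSubsets []            = here refl
∈-allSubsets (inside  ∷ p) = ∈-++⁺ˡ (∈-map⁺ (inside ∷_) (∈-allSubsets p))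
∈-allSubsets (outside ∷ p) = ∈-++⁺ʳ _ (∈-map⁺ (outside ∷_) (∈-allSubsets p))

foldr-⊓-≤ : ∀ {k n} {xs : List ℕ} → k ∈ₗ xs → foldr _⊓_ n xs ≤ k
foldr-⊓-≤ {n = n} {x ∷ xs} (here refl) = m⊓n≤m x (foldr _⊓_ n xs)
foldr-⊓-≤ {n = n} {x ∷ xs} (there k∈) = ≤-trans (m⊓n≤n x (foldr _⊓_ n xs)) (foldr-⊓-≤ k∈)

≤-foldr-⊓ : ∀ {k n} (xs : List ℕ) → k ≤ n → (∀ x → x ∈ₗ xs → k ≤ x) → k ≤ foldr _⊓_ n xs
≤-foldr-⊓ []       k≤n _ = k≤n
≤-foldr-⊓ (x ∷ xs) k≤n h = ⊓-glb (h x (here refl)) (≤-foldr-⊓ xs k≤n λ y → h y ∘ there)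

ν-minimum : ∀ G T F → IsMinimumJoin G T F → ν G T ≡ ∣ F ∣
ν-minimum G T F (F-join , F-min) = ≤-antisym
  (foldr-⊓-≤ (∈-map⁺ ∣_∣ (∈-filter⁺ (isJoin? G T) (∈-allSubsets F) F-join)))
  (≤-foldr-⊓ _ (∣p∣≤n F) below)
  where
  below : ∀ x → x ∈ₗ map ∣_∣ (filter (isJoin? G T) (allSubsets (Graph.size G))) → ∣ F ∣ ≤ x
  below x x∈ with ∈-map⁻ ∣_∣ x∈
  ... | F′ , F′∈ , refl =
    F-min F′ (proj₂ (∈-filter⁻ (isJoin? G T) {xs = allSubsets (Graph.size G)} F′∈))

{-# OPTIONS --safe #-}
module Submission where

-- For λ(a, b) = ν(T △ {a, b}) − ν(T), the theorem follows from the reverse triangle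
-- inequality λ(u, q) + λ(u, y) ≤ λ(q, y), valid whenever u and q are factor-connected.
-- It is proved by induction along a walk of allowed edges from u to q: an allowed edge
-- q q′ has λ(q, q′) = −1, and exchanging a path between minimum joins of T △ {q′, y} and
-- T △ {u, q} carries the inequality over from q to q′.  If u ∼ v ∼ w, the inequality
-- rooted at v gives λ(u, w) ≥ 0, and rooted at u with q = y = w it gives 2 λ(u, w) ≤ 0.

open import Defs
open import Data.Bool.Base using (Bool; true; false; not; _∧_; _∨_; _xor_; if_then_else_)
open import Data.Bool.Properties using (xor-same; xor-comm; xor-identityʳ; ¬-not; not-¬)
open import Data.Bool.Solver using (module xor-∧-Solver)
open import Data.Empty using (⊥-elim)
open import Data.Fin.Base using (Fin; zero; suc)
open import Data.Fin.Properties using (_≟_)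
open import Data.Fin.Subset using (Subset; inside; outside; _∈_; _∉_; _⊆_; _∩_; _∪_; _─_; ∣_∣; ⁅_⁆; ⊥; Nonempty)
open import Data.Fin.Subset.Properties
  using (_∈?_; ∣p∣≤n; x∈⁅x⁆; x∈⁅y⁆⇒x≡y; ∪-identityˡ; ∪-identityʳ; ∪-comm; drop-∷-⊆; ∉⊥;
         x∈p∩q⁻; ∣⁅x⁆∣≡1; ∣⊥∣≡0; ∩-zeroʳ; x∈p∪q⁺; x∈p∪q⁻; q⊆p∪q)
open import Data.List.Base using (List; []; _∷_; map; filter; foldr)
open import Data.List.Membership.Propositional using () renaming (_∈_ to _∈ₗ_)
open import Data.List.Membership.Propositional.Properties using (∈-map⁺; ∈-map⁻; ∈-filter⁺; ∈-filter⁻)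
open import Data.List.Relation.Unary.Any using (here; there)
open import Data.Nat.Base using (ℕ; zero; suc; _+_; _*_; _≤_; _<_; _⊓_; z≤n; s≤s)
open import Data.Nat.Divisibility using (_∣_; divides)
open import Data.Nat.Properties hiding (_≟_)
open import Data.Nat.Solver using (module +-*-Solver)
open import Data.Product.Base using (_×_; _,_; proj₁; proj₂; ∃; ∃-syntax)
open import Data.Sum.Base using (_⊎_; inj₁; inj₂; swap)
open import Data.Vec.Base using ([]; _∷_; lookup; zipWith; here; there)
open import Data.Vec.Properties using (lookup∘tabulate; tabulate∘lookup; tabulate-cong; lookup-zipWith; []=⇒lookup; lookup⇒[]=)
open import Function.Base using (_∘_; id)
open import Function.Bundles using (mk⇔; Equivalence)
open import Relation.Binary.Construct.Closure.ReflexiveTransitive using (Star; ε; _◅_; _◅◅_; gmap; reverse)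
open import Relation.Binary.PropositionalEquality using (_≡_; _≢_; refl; sym; trans; cong; cong₂; subst; module ≡-Reasoning)
open import Relation.Binary.Structures using (IsEquivalence)
open import Relation.Nullary using (¬_; yes; no; contradiction)
open import Relation.Nullary.Decidable using (does; dec-true; dec-false)

-- Subsets of a finite set as vectors over the two-element field.

private variable
  n : ℕ

infixl 6 _⊕_
_⊕_ : Subset n → Subset n → Subset n
_⊕_ = zipWith _xor_

-- Parity as a Boolean is linear with respect to `_⊕_`, so the degree conditions on joins become
-- equations over the two-element field that the `xor`-`∧` solver can settle. `odd⇒¬2∣` and
-- `even⇒2∣` lead back to divisibility.
isOdd : Subset n → Bool
isOdd []      = false
isOdd (x ∷ p) = x xor isOdd p

isOdd⇒∣∣ : (p : Subset n) → ∃[ k ] ∣ p ∣ ≡ (if isOdd p then 1 else 0) + k * 2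
isOdd⇒∣∣ []            = 0 , refl
isOdd⇒∣∣ (outside ∷ p) = isOdd⇒∣∣ p
isOdd⇒∣∣ (inside ∷ p) with isOdd p | isOdd⇒∣∣ p
... | true  | k , eq = suc k , cong suc eq
... | false | k , eq = k , cong suc eq

¬2∣1+2k : ∀ k → ¬ (2 ∣ 1 + k * 2)
¬2∣1+2k k (divides q eq) = odd≢even q k (sym eq)
  where
  odd≢even : ∀ q k → q * 2 ≢ 1 + k * 2
  odd≢even (suc q) (suc k) = odd≢even q k ∘ suc-injective ∘ suc-injective

odd⇒¬2∣ : (p : Subset n) → isOdd p ≡ true → ¬ (2 ∣ ∣ p ∣)
odd⇒¬2∣ p odd 2∣p with isOdd p | isOdd⇒∣∣ p
... | true | k , eq = ¬2∣1+2k k (subst (2 ∣_) eq 2∣p)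

even⇒2∣ : (p : Subset n) → isOdd p ≡ false → 2 ∣ ∣ p ∣
even⇒2∣ p even with isOdd p | isOdd⇒∣∣ p
... | false | k , eq = divides k eq

isOdd-∩-⊕ : (p q r : Subset n) → isOdd (p ∩ (q ⊕ r)) ≡ isOdd (p ∩ q) xor isOdd (p ∩ r)
isOdd-∩-⊕ [] [] [] = refl
isOdd-∩-⊕ (x ∷ p) (y ∷ q) (z ∷ r) = trans
  (cong ((x ∧ (y xor z)) xor_) (isOdd-∩-⊕ p q r))
  (solve 5 (λ x y z s t → (x :* (y :+ z)) :+ (s :+ t) := ((x :* y) :+ s) :+ ((x :* z) :+ t)) refl
    x y z (isOdd (p ∩ q)) (isOdd (p ∩ r)))
  where open xor-∧-Solver

isOdd-∩⊥ : (p : Subset n) → isOdd (p ∩ ⊥) ≡ false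
isOdd-∩⊥ []            = refl
isOdd-∩⊥ (outside ∷ p) = isOdd-∩⊥ p
isOdd-∩⊥ (inside ∷ p)  = isOdd-∩⊥ p

isOdd-∩⁅⁆ : (p : Subset n) (e : Fin n) → isOdd (p ∩ ⁅ e ⁆) ≡ lookup p e
isOdd-∩⁅⁆ (outside ∷ p) zero    = isOdd-∩⊥ p
isOdd-∩⁅⁆ (inside ∷ p)  zero    = cong not (isOdd-∩⊥ p)
isOdd-∩⁅⁆ (outside ∷ p) (suc e) = isOdd-∩⁅⁆ p e
isOdd-∩⁅⁆ (inside ∷ p)  (suc e) = isOdd-∩⁅⁆ p e

odd⇒Nonempty : (p : Subset n) → isOdd p ≡ true → Nonempty p
odd⇒Nonempty (inside ∷ p)  _   = zero , here
odd⇒Nonempty (outside ∷ p) odd with odd⇒Nonempty p odd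
... | e , e∈p = suc e , there e∈p

-- `f` is implicit so that unification finds it when the operation is visible only through
-- `zipWith`, as with `_─_`.
lookup-zipWith-≗ : ∀ {f g : Bool → Bool → Bool} → (∀ x y → f x y ≡ g x y) →
                   (p q : Subset n) (i : Fin n) → lookup (zipWith f p q) i ≡ g (lookup p i) (lookup q i)
lookup-zipWith-≗ {f = f} f≗g p q i = trans (lookup-zipWith f i p q) (f≗g (lookup p i) (lookup q i))

lookup-─ : (p q : Subset n) (i : Fin n) → lookup (p ─ q) i ≡ lookup p i ∧ not (lookup q i)
lookup-─ p q = lookup-zipWith-≗ {g = λ x y → x ∧ not y}
  (λ { false false → refl ; false true → refl ; true false → refl ; true true → refl }) p q

lookup-△ : (p q : Subset n) (i : Fin n) → lookup (p △ q) i ≡ lookup (p ⊕ q) i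
lookup-△ p q i
  rewrite lookup-zipWith _∨_ i (p ─ q) (q ─ p) | lookup-zipWith _xor_ i p q
        | lookup-─ p q i | lookup-─ q p i
  with lookup p i | lookup q i
... | false | false = refl
... | false | true  = refl
... | true  | false = refl
... | true  | true  = refl

△≡⊕ : (p q : Subset n) → p △ q ≡ p ⊕ q
△≡⊕ p q = trans (sym (tabulate∘lookup (p △ q)))
  (trans (tabulate-cong (lookup-△ p q)) (tabulate∘lookup (p ⊕ q)))

lookup-⊥ : (i : Fin n) → lookup ⊥ i ≡ false
lookup-⊥ zero    = refl
lookup-⊥ (suc i) = lookup-⊥ i

lookup-⁅⁆ : (x i : Fin n) → lookup ⁅ x ⁆ i ≡ does (x ≟ i)
lookup-⁅⁆ zero    zero    = refl
lookup-⁅⁆ zero    (suc i) = lookup-⊥ i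
lookup-⁅⁆ (suc x) zero    = refl
lookup-⁅⁆ (suc x) (suc i) = lookup-⁅⁆ x i

∣⊕∣≤ : (p q : Subset n) → ∣ p ⊕ q ∣ ≤ ∣ p ∣ + ∣ q ∣
∣⊕∣≤ [] [] = z≤n
∣⊕∣≤ (false ∷ p) (false ∷ q) = ∣⊕∣≤ p q
∣⊕∣≤ (false ∷ p) (true ∷ q)  = ≤-trans (s≤s (∣⊕∣≤ p q)) (≤-reflexive (sym (+-suc ∣ p ∣ ∣ q ∣)))
∣⊕∣≤ (true ∷ p)  (false ∷ q) = s≤s (∣⊕∣≤ p q)
∣⊕∣≤ (true ∷ p)  (true ∷ q)  = ≤-trans (∣⊕∣≤ p q) (m≤n⇒m≤1+n (+-monoʳ-≤ ∣ p ∣ (n≤1+n ∣ q ∣)))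

⊥⊕ : (p : Subset n) → ⊥ ⊕ p ≡ p
⊥⊕ []          = refl
⊥⊕ (false ∷ p) = cong (false ∷_) (⊥⊕ p)
⊥⊕ (true ∷ p)  = cong (true ∷_) (⊥⊕ p)

∣⁅x⁆⊕p∣ : {p : Subset n} {x : Fin n} → x ∈ p → suc ∣ ⁅ x ⁆ ⊕ p ∣ ≡ ∣ p ∣
∣⁅x⁆⊕p∣ (here {xs = p})        = cong (suc ∘ ∣_∣) (⊥⊕ p)
∣⁅x⁆⊕p∣ (there {y = false} x∈) = ∣⁅x⁆⊕p∣ x∈
∣⁅x⁆⊕p∣ (there {y = true} x∈)  = cong suc (∣⁅x⁆⊕p∣ x∈)

-- Each element of `r` lies in exactly one of `p` and `q`; adding `r` to both moves it from that set
-- to the other, which leaves the total unchanged.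
∣⊕∣-exchange : (p q r : Subset n) → r ⊆ p ⊕ q → ∣ p ⊕ r ∣ + ∣ q ⊕ r ∣ ≡ ∣ p ∣ + ∣ q ∣
∣⊕∣-exchange [] [] [] _ = refl
∣⊕∣-exchange (false ∷ p) (false ∷ q) (false ∷ r) ⊆⊕ = ∣⊕∣-exchange p q r (drop-∷-⊆ ⊆⊕)
∣⊕∣-exchange (false ∷ p) (false ∷ q) (true ∷ r)  ⊆⊕ = contradiction (⊆⊕ here) λ ()
∣⊕∣-exchange (false ∷ p) (true ∷ q)  (false ∷ r) ⊆⊕ =
  trans (+-suc ∣ p ⊕ r ∣ ∣ q ⊕ r ∣) (trans (cong suc (∣⊕∣-exchange p q r (drop-∷-⊆ ⊆⊕))) (sym (+-suc ∣ p ∣ ∣ q ∣)))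
∣⊕∣-exchange (false ∷ p) (true ∷ q)  (true ∷ r)  ⊆⊕ =
  trans (cong suc (∣⊕∣-exchange p q r (drop-∷-⊆ ⊆⊕))) (sym (+-suc ∣ p ∣ ∣ q ∣))
∣⊕∣-exchange (true ∷ p)  (false ∷ q) (false ∷ r) ⊆⊕ = cong suc (∣⊕∣-exchange p q r (drop-∷-⊆ ⊆⊕))
∣⊕∣-exchange (true ∷ p)  (false ∷ q) (true ∷ r)  ⊆⊕ =
  trans (+-suc ∣ p ⊕ r ∣ ∣ q ⊕ r ∣) (cong suc (∣⊕∣-exchange p q r (drop-∷-⊆ ⊆⊕)))
∣⊕∣-exchange (true ∷ p)  (true ∷ q)  (false ∷ r) ⊆⊕ = cong suc
  (trans (+-suc ∣ p ⊕ r ∣ ∣ q ⊕ r ∣) (trans (cong suc (∣⊕∣-exchange p q r (drop-∷-⊆ ⊆⊕))) (sym (+-suc ∣ p ∣ ∣ q ∣))))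
∣⊕∣-exchange (true ∷ p)  (true ∷ q)  (true ∷ r)  ⊆⊕ = contradiction (⊆⊕ here) λ ()

⁅⁆⊕⊆ : {p q : Subset n} {x : Fin n} → x ∈ p → q ⊆ p → ⁅ x ⁆ ⊕ q ⊆ p
⁅⁆⊕⊆ {p = p} {q} {x} x∈p q⊆p {i} i∈ with x ≟ i
... | yes refl = x∈p
... | no x≢i   = q⊆p (lookup⇒[]= i q (trans
  (sym (trans (lookup-zipWith _xor_ i ⁅ x ⁆ q)
    (cong (_xor lookup q i) (trans (lookup-⁅⁆ x i) (dec-false (x ≟ i) x≢i)))))
  ([]=⇒lookup i∈)))

⁅⁆∪⁅⁆≡⊕ : (x y : Fin n) → x ≢ y → ⁅ x ⁆ ∪ ⁅ y ⁆ ≡ ⁅ x ⁆ ⊕ ⁅ y ⁆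
⁅⁆∪⁅⁆≡⊕ zero    zero    x≢y = contradiction refl x≢y
⁅⁆∪⁅⁆≡⊕ zero    (suc y) _   = cong (inside ∷_) (trans (∪-identityˡ ⁅ y ⁆) (sym (⊥⊕ ⁅ y ⁆)))
⁅⁆∪⁅⁆≡⊕ (suc x) zero    _   = cong (inside ∷_) (trans (∪-identityʳ ⁅ x ⁆) (sym (⊕⊥ ⁅ x ⁆)))
  where
  ⊕⊥ : (p : Subset n) → p ⊕ ⊥ ≡ p
  ⊕⊥ []          = refl
  ⊕⊥ (false ∷ p) = cong (false ∷_) (⊕⊥ p)
  ⊕⊥ (true ∷ p)  = cong (true ∷_) (⊕⊥ p)
⁅⁆∪⁅⁆≡⊕ (suc x) (suc y) x≢y = cong (outside ∷_) (⁅⁆∪⁅⁆≡⊕ x y (x≢y ∘ cong suc))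

foldr-⊓-sel : ∀ k (xs : List ℕ) → foldr _⊓_ k xs ≡ k ⊎ foldr _⊓_ k xs ∈ₗ xs
foldr-⊓-sel k []       = inj₁ refl
foldr-⊓-sel k (x ∷ xs) with ⊓-sel x (foldr _⊓_ k xs) | foldr-⊓-sel k xs
... | inj₁ eq | _         = inj₂ (here eq)
... | inj₂ eq | inj₁ eq′  = inj₁ (trans eq eq′)
... | inj₂ eq | inj₂ ∈xs  = inj₂ (there (subst (_∈ₗ xs) (sym eq) ∈xs))

-- Boundaries modulo two and the paths they force.

module _ (G : Graph) where
  open Graph G

  χ : Vertex → Vertex → Bool
  χ x v = does (x ≟ v)

  χ-refl : ∀ x → χ x x ≡ true
  χ-refl x = dec-true (x ≟ x) refl

  ∂ : Subset size → Vertex → Bool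
  ∂ F v = isOdd (δ G v ∩ F)

  ∂-⊕ : ∀ F F′ v → ∂ (F ⊕ F′) v ≡ ∂ F v xor ∂ F′ v
  ∂-⊕ F F′ v = isOdd-∩-⊕ (δ G v) F F′

  -- For a loop the two terms cancel, in agreement with its absence from `δ`.
  lookup-δ : ∀ e v → lookup (δ G v) e ≡ χ (src e) v xor χ (tgt e) v
  lookup-δ e v = trans (lookup∘tabulate _ e) (lemma (χ (src e) v) (χ (tgt e) v))
    where
    lemma : ∀ s t → (s ∧ not t) ∨ (t ∧ not s) ≡ s xor t
    lemma false false = refl
    lemma false true  = refl
    lemma true  false = refl
    lemma true  true  = refl

  ∂-⁅⁆ : ∀ {e x y} → Joins G e x y → ∀ v → ∂ ⁅ e ⁆ v ≡ χ x v xor χ y v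
  ∂-⁅⁆ {e} (inj₁ (refl , refl)) v = trans (isOdd-∩⁅⁆ (δ G v) e) (lookup-δ e v)
  ∂-⁅⁆ {e} (inj₂ (refl , refl)) v =
    trans (isOdd-∩⁅⁆ (δ G v) e) (trans (lookup-δ e v) (xor-comm (χ (src e) v) (χ (tgt e) v)))

  ∈δ⇒Joins : ∀ {e a} → e ∈ δ G a → ∃[ c ] a ≢ c × Joins G e a c
  ∈δ⇒Joins {e} {a} e∈δ with src e ≟ a | tgt e ≟ a | trans (sym (lookup-δ e a)) ([]=⇒lookup e∈δ)
  ... | yes s≡a | no t≢a  | _ = tgt e , t≢a ∘ sym , inj₁ (s≡a , refl)
  ... | no s≢a  | yes t≡a | _ = src e , s≢a ∘ sym , inj₂ (refl , t≡a)

  -- Only the boundary of a path is recorded: the exchange arguments use nothing but parities, so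
  -- additional cycles do no harm. For `a ≡ b` the boundary is empty.
  IsPathSet : Vertex → Vertex → Subset size → Set
  IsPathSet a b P = ∀ v → ∂ P v ≡ χ a v xor χ b v

  ⊥-path : ∀ a → IsPathSet a a ⊥
  ⊥-path a v = trans (isOdd-∩⊥ (δ G v)) (sym (xor-same (χ a v)))

  -- Leave `a` along an edge `e` of `Z`. If its other end `c` is odd in `Z`, stop there. Otherwise
  -- delete `e`, which makes `c` odd, and continue from `c`; the size `k` of the remaining set
  -- decreases.
  odd⇒path : ∀ k Z a → ∣ Z ∣ ≡ k → ∂ Z a ≡ true →
             ∃[ b ] a ≢ b × ∂ Z b ≡ true × ∃[ P ] P ⊆ Z × IsPathSet a b P
  odd⇒path k Z a ∣Z∣≡k a-odd with odd⇒Nonempty (δ G a ∩ Z) a-odd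
  ... | e , e∈ with x∈p∩q⁻ (δ G a) Z e∈
  ... | e∈δ , e∈Z with ∈δ⇒Joins e∈δ
  ... | c , a≢c , joins with ∂ Z c in c-parity
  ... | true  = c , a≢c , c-parity , ⁅ e ⁆ ,
    (λ i∈ → subst (_∈ Z) (sym (x∈⁅y⁆⇒x≡y e i∈)) e∈Z) , ∂-⁅⁆ joins
  odd⇒path zero Z a ∣Z∣≡0 a-odd | e , _ | _ , e∈Z | _ | false =
    contradiction (trans (∣⁅x⁆⊕p∣ e∈Z) ∣Z∣≡0) λ ()
  odd⇒path (suc k) Z a ∣Z∣≡k a-odd | e , _ | _ , e∈Z | c , a≢c , joins | false =
    extend (odd⇒path k Z′ c (suc-injective (trans (∣⁅x⁆⊕p∣ e∈Z) ∣Z∣≡k)) c-odd)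
    where
    Z′ = ⁅ e ⁆ ⊕ Z

    ∂Z′ : ∀ v → ∂ Z′ v ≡ (χ a v xor χ c v) xor ∂ Z v
    ∂Z′ v = trans (∂-⊕ ⁅ e ⁆ Z v) (cong (_xor ∂ Z v) (∂-⁅⁆ joins v))

    c-odd : ∂ Z′ c ≡ true
    c-odd rewrite ∂Z′ c | c-parity | χ-refl c | dec-false (a ≟ c) a≢c = refl

    a-even : ∂ Z′ a ≡ false
    a-even rewrite ∂Z′ a | a-odd | χ-refl a | dec-false (c ≟ a) (a≢c ∘ sym) = refl

    extend : (∃[ b ] c ≢ b × ∂ Z′ b ≡ true × ∃[ P ] P ⊆ Z′ × IsPathSet c b P) →
             ∃[ b ] a ≢ b × ∂ Z b ≡ true × ∃[ P ] P ⊆ Z × IsPathSet a b P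
    extend (b , c≢b , b-odd′ , P , P⊆Z′ , ∂P) =
      b , a≢b , b-odd , ⁅ e ⁆ ⊕ P , ⁅⁆⊕⊆ e∈Z (⁅⁆⊕⊆ e∈Z id ∘ P⊆Z′) , ∂eP
      where
      -- Deleting `e` has made `a` even in `Z′`, whereas `b` is odd there; so the walk cannot end
      -- where it began.
      a≢b : a ≢ b
      a≢b refl with () ← trans (sym a-even) b-odd′

      b-odd : ∂ Z b ≡ true
      b-odd with ∂Z′ b
      ... | eq rewrite dec-false (a ≟ b) a≢b | dec-false (c ≟ b) c≢b = trans (sym eq) b-odd′

      ∂eP : IsPathSet a b (⁅ e ⁆ ⊕ P)
      ∂eP v rewrite ∂-⊕ ⁅ e ⁆ P v | ∂-⁅⁆ joins v | ∂P v =
        solve 3 (λ a b c → (a :+ c) :+ (c :+ b) := a :+ b) refl (χ a v) (χ b v) (χ c v)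
        where open xor-∧-Solver

  -- No distinctness is assumed: coincident points cancel modulo 2.
  four-points : ∀ Z a b c d → (∀ v → ∂ Z v ≡ (χ a v xor χ b v) xor (χ c v xor χ d v)) →
    ∃[ P ] P ⊆ Z × (IsPathSet a b P ⊎ IsPathSet a c P ⊎ IsPathSet a d P)
  four-points Z a b c d ∂Z with b ≟ a | c ≟ a | d ≟ a | ∂Z a
  ... | yes refl | _ | _ | _ = ⊥ , ⊥-elim ∘ ∉⊥ , inj₁ (⊥-path a)
  ... | no _ | yes refl | _ | _ = ⊥ , ⊥-elim ∘ ∉⊥ , inj₂ (inj₁ (⊥-path a))
  ... | no _ | no _ | yes refl | _ = ⊥ , ⊥-elim ∘ ∉⊥ , inj₂ (inj₂ (⊥-path a))
  -- None of `b`, `c`, `d` is `a`, so `a` is odd in `Z`. The other odd vertex `x` found from it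
  -- differs from `a`, hence is one of `b`, `c`, `d`.
  ... | no _ | no _ | no _ | ∂Za with odd⇒path ∣ Z ∣ Z a refl (trans ∂Za (cong (λ x → (x xor false) xor false) (χ-refl a)))
  ... | x , a≢x , x-odd , P , P⊆Z , ∂P = P , P⊆Z , pick (trans (sym (∂Z x)) x-odd)
    where
    pick : (χ a x xor χ b x) xor (χ c x xor χ d x) ≡ true →
           IsPathSet a b P ⊎ IsPathSet a c P ⊎ IsPathSet a d P
    pick eq with a ≟ x | b ≟ x | c ≟ x | d ≟ x
    ... | yes a≡x | _        | _        | _        = contradiction a≡x a≢x
    ... | no _    | yes refl | _        | _        = inj₁ ∂P
    ... | no _    | no _     | yes refl | _        = inj₂ (inj₁ ∂P)
    ... | no _    | no _     | no _     | yes refl = inj₂ (inj₂ ∂P)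

  -- Joins as edge sets with prescribed boundary, and the attainment of `ν`.

  isJoin⁻ : ∀ {T F} → IsJoin G T F → ∀ v → ∂ F v ≡ lookup T v
  isJoin⁻ {T} {F} F-join v with ∂ F v in parity | lookup T v in v∈?T
  ... | false | false = refl
  ... | true  | true  = refl
  ... | false | true  = contradiction (even⇒2∣ (δ G v ∩ F) parity) (proj₁ (F-join v) (lookup⇒[]= v T v∈?T))
  ... | true  | false = contradiction (proj₂ (F-join v) λ v∈T → not-¬ v∈?T ([]=⇒lookup v∈T)) (odd⇒¬2∣ (δ G v ∩ F) parity)

  isJoin⁺ : ∀ {T F} → (∀ v → ∂ F v ≡ lookup T v) → IsJoin G T F
  isJoin⁺ {T} {F} eq v =
    (λ v∈T → odd⇒¬2∣ (δ G v ∩ F) (trans (eq v) ([]=⇒lookup v∈T))) ,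
    (λ v∉T → even⇒2∣ (δ G v ∩ F) (trans (eq v) (¬-not (v∉T ∘ lookup⇒[]= v T))))

  ν≤ : ∀ {T F} → IsJoin G T F → ν G T ≤ ∣ F ∣
  ν≤ {T} {F} F-join = foldr-⊓-≤ (∈-map⁺ ∣_∣ (∈-filter⁺ (isJoin? G T) (∈-allSubsets F) F-join))

  ν-attained : ∀ {T F} → IsJoin G T F → ∃[ F′ ] IsJoin G T F′ × ∣ F′ ∣ ≡ ν G T
  ν-attained {T} {F} F-join
    with foldr-⊓-sel size (map ∣_∣ (filter (isJoin? G T) (allSubsets size)))
  -- If the minimum is the default value `size`, the given join `F` attains it, since no edge set is
  -- larger.
  ... | inj₁ ν≡size = F , F-join , ≤-antisym (≤-trans (∣p∣≤n F) (≤-reflexive (sym ν≡size))) (ν≤ F-join)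
  ... | inj₂ ν∈ with ∈-map⁻ ∣_∣ ν∈
  ... | F′ , F′∈ , ν≡∣F′∣ =
    F′ , proj₂ (∈-filter⁻ (isJoin? G T) {xs = allSubsets size} F′∈) , sym ν≡∣F′∣

-- Simple paths, their degrees, and loop erasure.

𝟙 : Bool → ℕ
𝟙 b = if b then 1 else 0

∣p∩⊥∣≡0 : (p : Subset n) → ∣ p ∩ ⊥ ∣ ≡ 0
∣p∩⊥∣≡0 {n} p = trans (cong ∣_∣ (∩-zeroʳ p)) (∣⊥∣≡0 n)

∣p∩⁅x⁆∪q∣ : (p q : Subset n) (x : Fin n) → x ∉ q → ∣ p ∩ (⁅ x ⁆ ∪ q) ∣ ≡ 𝟙 (lookup p x) + ∣ p ∩ q ∣
∣p∩⁅x⁆∪q∣ (_ ∷ p)     (true ∷ q)  zero    x∉q = contradiction here x∉q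
∣p∩⁅x⁆∪q∣ (false ∷ p) (false ∷ q) zero    x∉q = cong (λ r → ∣ p ∩ r ∣) (∪-identityˡ q)
∣p∩⁅x⁆∪q∣ (true ∷ p)  (false ∷ q) zero    x∉q = cong (λ r → suc ∣ p ∩ r ∣) (∪-identityˡ q)
∣p∩⁅x⁆∪q∣ (false ∷ p) (_ ∷ q)     (suc x) x∉q = ∣p∩⁅x⁆∪q∣ p q x (x∉q ∘ there)
∣p∩⁅x⁆∪q∣ (true ∷ p)  (false ∷ q) (suc x) x∉q = ∣p∩⁅x⁆∪q∣ p q x (x∉q ∘ there)
∣p∩⁅x⁆∪q∣ (true ∷ p)  (true ∷ q)  (suc x) x∉q =
  trans (cong suc (∣p∩⁅x⁆∪q∣ p q x (x∉q ∘ there))) (sym (+-suc (𝟙 (lookup p x)) ∣ p ∩ q ∣))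

module SimplePaths (G : Graph) (Good : Fin (Graph.size G) → Set) where
  open Graph G

  GoodStep : Vertex → Vertex → Set
  GoodStep x y = ∃[ e ] Good e × Joins G e x y

  -- The path grows at its start, and freshness of the new vertex `u` is the only simplicity
  -- condition: it forces the new edge to be fresh (`edges-∌`) and excludes loops, since the old
  -- start already lies in `V`.
  data SimplePath (b : Vertex) : Vertex → Subset order → Subset size → Set where
    nil  : SimplePath b b ⁅ b ⁆ ⊥
    cons : ∀ {e u a V E} → Good e → Joins G e u a → u ∉ V → SimplePath b a V E →
           SimplePath b u (⁅ u ⁆ ∪ V) (⁅ e ⁆ ∪ E)

  start∈ : ∀ {a b V E} → SimplePath b a V E → a ∈ V
  start∈ {b = b} nil              = x∈⁅x⁆ b
  start∈ (cons {u = u} _ _ _ _) = x∈p∪q⁺ (inj₁ (x∈⁅x⁆ u))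

  ends∈ : ∀ {a b V E} → SimplePath b a V E → ∀ e → e ∈ E → src e ∈ V × tgt e ∈ V
  ends∈ nil e e∈ = contradiction e∈ ∉⊥
  ends∈ (cons {e′} {u} {a} {V} {E} _ joins _ path) e e∈ with x∈p∪q⁻ ⁅ e′ ⁆ E e∈
  ... | inj₂ e∈E with ends∈ path e e∈E
  ...   | s∈ , t∈ = x∈p∪q⁺ (inj₂ s∈) , x∈p∪q⁺ (inj₂ t∈)
  ends∈ (cons {e′} {u} _ joins _ path) e e∈ | inj₁ e∈⁅⁆ with x∈⁅y⁆⇒x≡y e′ e∈⁅⁆ | joins
  ...   | refl | inj₁ (refl , refl) = x∈p∪q⁺ (inj₁ (x∈⁅x⁆ u)) , x∈p∪q⁺ (inj₂ (start∈ path))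
  ...   | refl | inj₂ (refl , refl) = x∈p∪q⁺ (inj₂ (start∈ path)) , x∈p∪q⁺ (inj₁ (x∈⁅x⁆ u))

  good : ∀ {a b V E} → SimplePath b a V E → ∀ e → e ∈ E → Good e
  good nil e e∈ = contradiction e∈ ∉⊥
  good (cons {e′} {E = E} e′-good _ _ path) e e∈ with x∈p∪q⁻ ⁅ e′ ⁆ E e∈
  ... | inj₁ e∈⁅⁆ = subst Good (sym (x∈⁅y⁆⇒x≡y e′ e∈⁅⁆)) e′-good
  ... | inj₂ e∈E  = good path e e∈E

  Star-mono : ∀ {E E′} → E ⊆ E′ → ∀ {x y} → Star (Step G E) x y → Star (Step G E′) x y
  Star-mono E⊆E′ = gmap id λ (e , e∈ , joins) → e , E⊆E′ e∈ , joins

  toEnd : ∀ {a b V E} → SimplePath b a V E → ∀ x → x ∈ V → Star (Step G E) x b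
  toEnd {b = b} nil x x∈ with x∈⁅y⁆⇒x≡y b x∈
  ... | refl = ε
  toEnd (cons {e} {u} {a} {V} {E} _ joins _ path) x x∈ with x∈p∪q⁻ ⁅ u ⁆ V x∈
  ... | inj₂ x∈V = Star-mono (q⊆p∪q ⁅ e ⁆ E) (toEnd path x x∈V)
  ... | inj₁ x∈⁅u⁆ with x∈⁅y⁆⇒x≡y u x∈⁅u⁆
  ...   | refl = (e , x∈p∪q⁺ (inj₁ (x∈⁅x⁆ e)) , joins)
                 ◅ Star-mono (q⊆p∪q ⁅ e ⁆ E) (toEnd path a (start∈ path))

  subgraph : ∀ {a b V E} → SimplePath b a V E → Subgraph G
  subgraph {V = V} {E} path = record { vertices = V ; edges = E ; closed = ends∈ path }

  edgesFrom edgesTo : Vertex → Subset size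
  edgesFrom x = comprehension (λ e → src e ≟ x)
  edgesTo   x = comprehension (λ e → tgt e ≟ x)

  edges-∌ : ∀ {e u a b c V E} → SimplePath b a V E → u ∉ V → Joins G e u c → e ∉ E
  edges-∌ {e} path u∉V joins e∈E with ends∈ path e e∈E | joins
  ... | s∈ , _ | inj₁ (refl , _) = u∉V s∈
  ... | _ , t∈ | inj₂ (_ , refl) = u∉V t∈

  𝟙-ends : ∀ {e u a} → Joins G e u a → ∀ x →
           𝟙 (lookup (edgesFrom x) e) + 𝟙 (lookup (edgesTo x) e) ≡ 𝟙 (χ G u x) + 𝟙 (χ G a x)
  𝟙-ends {e} joins x
    rewrite lookup∘tabulate (λ e → does (src e ≟ x)) e | lookup∘tabulate (λ e → does (tgt e ≟ x)) e
    with joins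
  ... | inj₁ (refl , refl) = refl
  ... | inj₂ (refl , refl) = +-comm (𝟙 (χ G (src e) x)) (𝟙 (χ G (tgt e) x))

  -- On a path every vertex has degree two, once each end is counted as an extra half-edge.
  degree-equation : ∀ {a b V E} (path : SimplePath b a V E) → ∀ x →
    degree G (subgraph path) x + (𝟙 (χ G a x) + 𝟙 (χ G b x)) ≡ 2 * 𝟙 (lookup V x)
  degree-equation {b = b} nil x
    rewrite ∣p∩⊥∣≡0 (edgesFrom x) | ∣p∩⊥∣≡0 (edgesTo x) | lookup-⁅⁆ b x =
    cong (𝟙 (χ G b x) +_) (sym (+-identityʳ (𝟙 (χ G b x))))
  degree-equation {b = b} (cons {e} {u} {a} {V} {E} _ joins u∉V path) x = begin
    ∣ edgesFrom x ∩ (⁅ e ⁆ ∪ E) ∣ + ∣ edgesTo x ∩ (⁅ e ⁆ ∪ E) ∣ + (χu + χb)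
      ≡⟨ cong (_+ (χu + χb)) (cong₂ _+_ (∣p∩⁅x⁆∪q∣ (edgesFrom x) E e e∉E) (∣p∩⁅x⁆∪q∣ (edgesTo x) E e e∉E)) ⟩
    (s + d₁) + (t + d₂) + (χu + χb)
      ≡⟨ solve 6 (λ s d t e u b → ((s :+ d) :+ (t :+ e)) :+ (u :+ b) := (s :+ t) :+ ((d :+ e) :+ (u :+ b))) refl s d₁ t d₂ χu χb ⟩
    (s + t) + ((d₁ + d₂) + (χu + χb))
      -- The new edge gives one half-edge to `u` and one to `a`. The latter replaces the extra
      -- half-edge that `a` had as an end of the shorter path; `u` now gets its own.
      ≡⟨ cong (_+ ((d₁ + d₂) + (χu + χb))) (𝟙-ends joins x) ⟩
    (χu + χa) + ((d₁ + d₂) + (χu + χb))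
      ≡⟨ solve 4 (λ u a d b → (u :+ a) :+ (d :+ (u :+ b)) := (u :+ u) :+ (d :+ (a :+ b))) refl χu χa (d₁ + d₂) χb ⟩
    (χu + χu) + ((d₁ + d₂) + (χa + χb))
      ≡⟨ cong ((χu + χu) +_) (degree-equation path x) ⟩
    (χu + χu) + 2 * 𝟙 (lookup V x)
      ≡⟨ solve 2 (λ u v → (u :+ u) :+ (con 2 :* v) := con 2 :* (u :+ v)) refl χu (𝟙 (lookup V x)) ⟩
    2 * (χu + 𝟙 (lookup V x))
      ≡⟨ cong (2 *_) 𝟙-∪ ⟨
    2 * 𝟙 (lookup (⁅ u ⁆ ∪ V) x) ∎
    where
    open ≡-Reasoning
    open +-*-Solver
    χu = 𝟙 (χ G u x)
    χa = 𝟙 (χ G a x)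
    χb = 𝟙 (χ G b x)
    s  = 𝟙 (lookup (edgesFrom x) e)
    t  = 𝟙 (lookup (edgesTo x) e)
    d₁ = ∣ edgesFrom x ∩ E ∣
    d₂ = ∣ edgesTo x ∩ E ∣

    e∉E : e ∉ E
    e∉E = edges-∌ path u∉V joins

    𝟙-∪ : 𝟙 (lookup (⁅ u ⁆ ∪ V) x) ≡ χu + 𝟙 (lookup V x)
    𝟙-∪ rewrite lookup-zipWith _∨_ x ⁅ u ⁆ V | lookup-⁅⁆ u x with u ≟ x | lookup V x in x∈?V
    ... | yes refl | true  = contradiction (lookup⇒[]= x V x∈?V) u∉V
    ... | yes _    | false = refl
    ... | no _     | _     = refl

  -- By `degree-equation`, the degree of a vertex on the path is two minus the number of ends it
  -- represents: two inside, one at an end, and zero when the path is a single vertex.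
  isPathBetween : ∀ {a b V E} (path : SimplePath b a V E) → IsPathBetween G (subgraph path) a b
  isPathBetween {a} {b} {V} {E} path =
    (((a , start∈ path) , connected) , degree≤2 , (a , ends-degree (inj₁ refl))) ,
    λ x → mk⇔ (degree<2⇒end x) ends-degree
    where
    H = subgraph path

    connected : ∀ x y → x ∈ V → y ∈ V → Star (Step G E) x y
    connected x y x∈ y∈ = toEnd path x x∈ ◅◅ reverse (λ (e , e∈ , js) → e , e∈ , swap js) (toEnd path y y∈)

    degree≤2 : ∀ v → v ∈ V → degree G H v ≤ 2
    degree≤2 v v∈ = m+n≤o⇒m≤o (degree G H v)
      (≤-reflexive (trans (degree-equation path v) (cong (λ b → 2 * 𝟙 b) ([]=⇒lookup v∈))))

    degree<2⇒end : ∀ x → x ∈ V × degree G H x < 2 → x ≡ a ⊎ x ≡ b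
    degree<2⇒end x (x∈ , d<2) with a ≟ x | b ≟ x | degree-equation path x
    ... | yes refl | _        | _  = inj₁ refl
    ... | no _     | yes refl | _  = inj₂ refl
    ... | no _     | no _     | eq = contradiction
      (trans (sym (+-identityʳ _)) (trans eq (cong (λ b → 2 * 𝟙 b) ([]=⇒lookup x∈)))) (<⇒≢ d<2)

    -- Here `k` counts the extra half-edges at an end. It makes the left side positive, which rules
    -- out `c ≡ false` and leaves `d` below two.
    positive : ∀ d k c → 1 ≤ k → d + k ≡ 2 * 𝟙 c → c ≡ true × d < 2
    positive d (suc k) true  _ eq = refl , ≤-trans (s≤s (m≤m+n d k)) (≤-reflexive (trans (sym (+-suc d k)) eq))
    positive d (suc k) false _ eq = contradiction (trans (sym (+-suc d k)) eq) λ ()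

    ends-degree : ∀ {x} → x ≡ a ⊎ x ≡ b → x ∈ V × degree G H x < 2
    ends-degree {x} x-end with positive (degree G H x) _ (lookup V x) (end-counted x-end) (degree-equation path x)
      where
      end-counted : x ≡ a ⊎ x ≡ b → 1 ≤ 𝟙 (χ G a x) + 𝟙 (χ G b x)
      end-counted (inj₁ refl) rewrite χ-refl G x = s≤s z≤n
      end-counted (inj₂ refl) rewrite χ-refl G x = m≤n+m 1 (𝟙 (χ G a x))
    ... | x∈?V , d<2 = lookup⇒[]= x V x∈?V , d<2

  suffix : ∀ {a b u V E} → SimplePath b a V E → u ∈ V → ∃[ V′ ] ∃[ E′ ] SimplePath b u V′ E′
  suffix {b = b} nil u∈ with x∈⁅y⁆⇒x≡y b u∈
  ... | refl = _ , _ , nil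
  suffix path@(cons {u = a} {V = V} _ _ _ path′) u∈ with x∈p∪q⁻ ⁅ a ⁆ V u∈
  ... | inj₂ u∈V = suffix path′ u∈V
  ... | inj₁ u∈⁅a⁆ with x∈⁅y⁆⇒x≡y a u∈⁅a⁆
  ...   | refl = _ , _ , path

  -- Loop erasure: when the walk returns to a vertex of the simple path built so far, `suffix` cuts
  -- off the detour.
  simplify : ∀ {a b} → Star GoodStep a b → ∃[ V ] ∃[ E ] SimplePath b a V E
  simplify ε = _ , _ , nil
  simplify {a} ((e , e-good , joins) ◅ walk) with simplify walk
  ... | V , E , path with a ∈? V
  ...   | yes a∈V = suffix path a∈V
  ...   | no a∉V  = _ , _ , cons e-good joins a∉V path

-- The reverse triangle inequality along allowed edges.

module _ (Γ : Graft) where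
  open Graft Γ renaming (graph to G; terminals to T)

  open SimplePaths G (Allowed Γ) using (simplify; subgraph; isPathBetween; good)
    renaming (GoodStep to AllowedStep)

  -- T + {a , b} modulo 2, so that a ≡ b is allowed.
  T⊕ : Vertex → Vertex → Subset order
  T⊕ a b = T ⊕ (⁅ a ⁆ ⊕ ⁅ b ⁆)

  N : Vertex → Vertex → ℕ
  N a b = ν G (T⊕ a b)

  IsJoin⊕ : Vertex → Vertex → Subset size → Set
  IsJoin⊕ a b F = ∀ v → ∂ G F v ≡ lookup T v xor (χ G a v xor χ G b v)

  -- Without a join, `N a b` would be the default value `size`. Existence is carried as a hypothesis
  -- wherever a join attaining `N a b` must be chosen.
  HasJoin : Vertex → Vertex → Set
  HasJoin a b = ∃ (IsJoin⊕ a b)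

  lookup-T⊕ : ∀ a b v → lookup (T⊕ a b) v ≡ lookup T v xor (χ G a v xor χ G b v)
  lookup-T⊕ a b v
    rewrite lookup-zipWith _xor_ v T (⁅ a ⁆ ⊕ ⁅ b ⁆) | lookup-zipWith _xor_ v ⁅ a ⁆ ⁅ b ⁆
          | lookup-⁅⁆ a v | lookup-⁅⁆ b v = refl

  N≤ : ∀ {a b F} → IsJoin⊕ a b F → N a b ≤ ∣ F ∣
  N≤ {a} {b} F-J = ν≤ G (isJoin⁺ G λ v → trans (F-J v) (sym (lookup-T⊕ a b v)))

  N-attained : ∀ {a b} → HasJoin a b → ∃[ F ] IsJoin⊕ a b F × ∣ F ∣ ≡ N a b
  N-attained {a} {b} (F , F-J)
    with ν-attained G (isJoin⁺ G {T⊕ a b} λ v → trans (F-J v) (sym (lookup-T⊕ a b v)))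
  ... | F′ , F′-join , eq = F′ , (λ v → trans (isJoin⁻ G F′-join v) (lookup-T⊕ a b v)) , eq

  T⊕-diagonal : ∀ a → T⊕ a a ≡ T
  T⊕-diagonal a = trans (sym (tabulate∘lookup (T⊕ a a)))
    (trans (tabulate-cong eq) (tabulate∘lookup T))
    where
    eq : ∀ v → lookup (T⊕ a a) v ≡ lookup T v
    eq v rewrite lookup-T⊕ a a v | xor-same (χ G a v) = xor-identityʳ (lookup T v)

  N-diagonal : ∀ a → N a a ≡ ν G T
  N-diagonal a = cong (ν G) (T⊕-diagonal a)

  edge-step : ∀ {e x y} → Joins G e x y → ∀ {a F} → IsJoin⊕ a x F → IsJoin⊕ a y (⁅ e ⁆ ⊕ F)
  edge-step {e} {x} {y} joins {a} {F} F-J v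
    rewrite ∂-⊕ G ⁅ e ⁆ F v | ∂-⁅⁆ G joins v | F-J v =
    solve 4 (λ a x y t → (x :+ y) :+ (t :+ (a :+ x)) := t :+ (a :+ y)) refl
      (χ G a v) (χ G x v) (χ G y v) (lookup T v)
    where open xor-∧-Solver

  minimumJoin : ∀ {F} a → IsMinimumJoin G T F → IsJoin⊕ a a F
  minimumJoin a (F-join , _) v =
    trans (isJoin⁻ G F-join v) (sym (trans (cong (lookup T v xor_) (xor-same (χ G a v))) (xor-identityʳ _)))

  -- Deleting `e` from a minimum join `F` that contains it leaves a join of `T` + {`x`, `y`} with
  -- one edge fewer.
  allowed⇒N< : ∀ {x y} → AllowedStep x y → suc (N x y) ≤ ν G T
  allowed⇒N< {x} {y} (e , (F , F-min , e∈F) , joins) = begin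
    suc (N x y)            ≤⟨ s≤s (N≤ {x} {y} (edge-step joins {x} (minimumJoin x F-min))) ⟩
    suc ∣ ⁅ e ⁆ ⊕ F ∣      ≡⟨ ∣⁅x⁆⊕p∣ e∈F ⟩
    ∣ F ∣                  ≡⟨ ν-minimum G T F F-min ⟨
    ν G T                  ∎
    where open ≤-Reasoning

  -- The third summand `F` restores the copy of `T` that cancels between `A` and `B`. This provides
  -- the join of `T` + {`q′`, `y`} that `exchange` requires.
  IsJoin⊕-combine : ∀ {u a b F A B} → IsJoin⊕ u u F → IsJoin⊕ u a A → IsJoin⊕ u b B → IsJoin⊕ a b ((A ⊕ B) ⊕ F)
  IsJoin⊕-combine {u} {a} {b} {F} {A} {B} F-J A-J B-J v
    rewrite ∂-⊕ G (A ⊕ B) F v | ∂-⊕ G A B v | F-J v | A-J v | B-J v =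
    solve 4 (λ u a b t → ((t :+ (u :+ a)) :+ (t :+ (u :+ b))) :+ (t :+ (u :+ u)) := t :+ (a :+ b)) refl
      (χ G u v) (χ G a v) (χ G b v) (lookup T v)
    where open xor-∧-Solver

  -- Take minimum joins X of T + {q′ , y} and Y of T + {u , q}.  Their sum contains a
  -- path P from y to one of q′, u, q, and X ⊕ P, Y ⊕ P have the same total size; when P
  -- does not end in u, adding the edge q q′ brings the other two points back together.
  exchange : ∀ {u q q′ y e} → Joins G e q q′ → HasJoin q′ y → HasJoin u q →
             (ν G T + N u y ≤ suc (N q′ y + N u q)) ⊎ (N u q′ + N q y ≤ N q′ y + N u q)
  exchange {u} {q} {q′} {y} {e} joins has-q′y has-uq
    with N-attained has-q′y | N-attained has-uq
  ... | X , X-J , ∣X∣≡ | Y , Y-J , ∣Y∣≡ = cases (four-points G (X ⊕ Y) y q′ u q ∂XY)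
    where
    open xor-∧-Solver
    open ≤-Reasoning

    ∂XY : ∀ v → ∂ G (X ⊕ Y) v ≡ (χ G y v xor χ G q′ v) xor (χ G u v xor χ G q v)
    ∂XY v rewrite ∂-⊕ G X Y v | X-J v | Y-J v =
      solve 5 (λ y q′ u q t → (t :+ (q′ :+ y)) :+ (t :+ (u :+ q)) := (y :+ q′) :+ (u :+ q)) refl
        (χ G y v) (χ G q′ v) (χ G u v) (χ G q v) (lookup T v)

    total : ∀ {P} → P ⊆ X ⊕ Y → ∣ X ⊕ P ∣ + ∣ Y ⊕ P ∣ ≡ N q′ y + N u q
    total {P} P⊆ = trans (∣⊕∣-exchange X Y P P⊆) (cong₂ _+_ ∣X∣≡ ∣Y∣≡)

    cases : (∃[ P ] P ⊆ X ⊕ Y × (IsPathSet G y q′ P ⊎ IsPathSet G y u P ⊎ IsPathSet G y q P)) →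
            (ν G T + N u y ≤ suc (N q′ y + N u q)) ⊎ (N u q′ + N q y ≤ N q′ y + N u q)
    cases (P , P⊆ , inj₁ ∂P) = inj₁ (begin
      ν G T + N u y                          ≡⟨ cong (_+ N u y) (N-diagonal u) ⟨
      N u u + N u y                          ≤⟨ +-mono-≤ (N≤ X′-J) (≤-trans (N≤ Y′-J) (∣⊕∣≤ ⁅ e ⁆ (Y ⊕ P))) ⟩
      ∣ X ⊕ P ∣ + (∣ ⁅ e ⁆ ∣ + ∣ Y ⊕ P ∣)    ≡⟨ cong (λ k → ∣ X ⊕ P ∣ + (k + ∣ Y ⊕ P ∣)) (∣⁅x⁆∣≡1 e) ⟩
      ∣ X ⊕ P ∣ + suc ∣ Y ⊕ P ∣              ≡⟨ +-suc ∣ X ⊕ P ∣ ∣ Y ⊕ P ∣ ⟩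
      suc (∣ X ⊕ P ∣ + ∣ Y ⊕ P ∣)            ≡⟨ cong suc (total P⊆) ⟩
      suc (N q′ y + N u q)                   ∎)
      where
      X′-J : IsJoin⊕ u u (X ⊕ P)
      X′-J v rewrite ∂-⊕ G X P v | X-J v | ∂P v =
        solve 4 (λ y q′ u t → (t :+ (q′ :+ y)) :+ (y :+ q′) := t :+ (u :+ u)) refl
          (χ G y v) (χ G q′ v) (χ G u v) (lookup T v)

      Y′-J : IsJoin⊕ u y (⁅ e ⁆ ⊕ (Y ⊕ P))
      Y′-J v rewrite ∂-⊕ G ⁅ e ⁆ (Y ⊕ P) v | ∂-⊕ G Y P v | ∂-⁅⁆ G joins v | Y-J v | ∂P v =
        solve 5 (λ y q′ u q t → (q :+ q′) :+ ((t :+ (u :+ q)) :+ (y :+ q′)) := t :+ (u :+ y)) refl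
          (χ G y v) (χ G q′ v) (χ G u v) (χ G q v) (lookup T v)
    cases (P , P⊆ , inj₂ (inj₁ ∂P)) = inj₂ (begin
      N u q′ + N q y             ≤⟨ +-mono-≤ (N≤ X′-J) (N≤ Y′-J) ⟩
      ∣ X ⊕ P ∣ + ∣ Y ⊕ P ∣      ≡⟨ total P⊆ ⟩
      N q′ y + N u q             ∎)
      where
      X′-J : IsJoin⊕ u q′ (X ⊕ P)
      X′-J v rewrite ∂-⊕ G X P v | X-J v | ∂P v =
        solve 4 (λ y q′ u t → (t :+ (q′ :+ y)) :+ (y :+ u) := t :+ (u :+ q′)) refl
          (χ G y v) (χ G q′ v) (χ G u v) (lookup T v)

      Y′-J : IsJoin⊕ q y (Y ⊕ P)
      Y′-J v rewrite ∂-⊕ G Y P v | Y-J v | ∂P v =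
        solve 4 (λ y u q t → (t :+ (u :+ q)) :+ (y :+ u) := t :+ (q :+ y)) refl
          (χ G y v) (χ G u v) (χ G q v) (lookup T v)
    cases (P , P⊆ , inj₂ (inj₂ ∂P)) = inj₁ (begin
      ν G T + N u y                            ≡⟨ cong (_+ N u y) (N-diagonal u) ⟨
      N u u + N u y                            ≤⟨ +-mono-≤ (≤-trans (N≤ X′-J) (∣⊕∣≤ ⁅ e ⁆ (X ⊕ P))) (N≤ Y′-J) ⟩
      (∣ ⁅ e ⁆ ∣ + ∣ X ⊕ P ∣) + ∣ Y ⊕ P ∣      ≡⟨ cong (λ k → k + ∣ X ⊕ P ∣ + ∣ Y ⊕ P ∣) (∣⁅x⁆∣≡1 e) ⟩
      suc (∣ X ⊕ P ∣ + ∣ Y ⊕ P ∣)              ≡⟨ cong suc (total P⊆) ⟩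
      suc (N q′ y + N u q)                     ∎)
      where
      X′-J : IsJoin⊕ u u (⁅ e ⁆ ⊕ (X ⊕ P))
      X′-J v rewrite ∂-⊕ G ⁅ e ⁆ (X ⊕ P) v | ∂-⊕ G X P v | ∂-⁅⁆ G joins v | X-J v | ∂P v =
        solve 5 (λ y q′ u q t → (q :+ q′) :+ ((t :+ (q′ :+ y)) :+ (y :+ q)) := t :+ (u :+ u)) refl
          (χ G y v) (χ G q′ v) (χ G u v) (χ G q v) (lookup T v)

      Y′-J : IsJoin⊕ u y (Y ⊕ P)
      Y′-J v rewrite ∂-⊕ G Y P v | Y-J v | ∂P v =
        solve 4 (λ y u q t → (t :+ (u :+ q)) :+ (y :+ q) := t :+ (u :+ y)) refl
          (χ G y v) (χ G u v) (χ G q v) (lookup T v)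

  -- λ u q + λ u y ≤ λ q y for λ a b = N a b − ν G T, moved so as to avoid subtraction.
  ReverseTriangle : Vertex → Vertex → Set
  ReverseTriangle u q = HasJoin u q × (∀ y → HasJoin u y → N u q + N u y ≤ ν G T + N q y)

  reverseTriangle-refl : ∀ {u} → HasJoin u u → ReverseTriangle u u
  reverseTriangle-refl {u} has = has , λ y _ → ≤-reflexive (cong (_+ N u y) (N-diagonal u))

  reverseTriangle-step : ∀ {u q q′} → HasJoin u u → AllowedStep q q′ →
                         ReverseTriangle u q → ReverseTriangle u q′
  reverseTriangle-step {u} {q} {q′} (F₀ , F₀-J) step@(e , _ , joins) ((F , F-J) , ih) =
    (⁅ e ⁆ ⊕ F , F′-J) , bound
    where
    open ≤-Reasoning
    open +-*-Solver
    t = ν G T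

    F′-J : IsJoin⊕ u q′ (⁅ e ⁆ ⊕ F)
    F′-J = edge-step joins {u} F-J

    bound : ∀ y → HasJoin u y → N u q′ + N u y ≤ t + N q′ y
    bound y has-y with exchange joins (_ , IsJoin⊕-combine {u} {q′} {y} F₀-J F′-J (proj₂ has-y)) (F , F-J)
    -- Here `le` says λ(u, y) ≤ λ(q′, y) + λ(u, q) + 1. The induction hypothesis at `q′` and the
    -- allowed edge give λ(u, q) + λ(u, q′) ≤ λ(q, q′) ≤ -1, and the sum is the claim.
    ... | inj₁ le = +-cancelʳ-≤ (N u q + t) _ _ (begin
      (N u q′ + N u y) + (N u q + t)
        ≡⟨ solve 4 (λ a b c t → (a :+ b) :+ (c :+ t) := (c :+ a) :+ (t :+ b)) refl (N u q′) (N u y) (N u q) t ⟩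
      (N u q + N u q′) + (t + N u y)        ≤⟨ +-mono-≤ (ih q′ (_ , F′-J)) le ⟩
      (t + N q q′) + suc (N q′ y + N u q)
        ≡⟨ solve 4 (λ t a b c → (t :+ a) :+ (con 1 :+ (b :+ c)) := (t :+ b) :+ (c :+ (con 1 :+ a))) refl t (N q q′) (N q′ y) (N u q) ⟩
      (t + N q′ y) + (N u q + suc (N q q′)) ≤⟨ +-monoʳ-≤ (t + N q′ y) (+-monoʳ-≤ (N u q) (allowed⇒N< step)) ⟩
      (t + N q′ y) + (N u q + t)            ∎)
    -- Here `le` says λ(u, q′) + λ(q, y) ≤ λ(q′, y) + λ(u, q). Adding the induction hypothesis at
    -- `y` cancels λ(q, y) and λ(u, q).
    ... | inj₂ le = +-cancelʳ-≤ (N q y + N u q) _ _ (begin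
      (N u q′ + N u y) + (N q y + N u q)
        ≡⟨ solve 4 (λ a b c d → (a :+ b) :+ (c :+ d) := (a :+ c) :+ (d :+ b)) refl (N u q′) (N u y) (N q y) (N u q) ⟩
      (N u q′ + N q y) + (N u q + N u y)    ≤⟨ +-mono-≤ le (ih y has-y) ⟩
      (N q′ y + N u q) + (t + N q y)
        ≡⟨ solve 4 (λ a b t c → (a :+ b) :+ (t :+ c) := (t :+ a) :+ (c :+ b)) refl (N q′ y) (N u q) t (N q y) ⟩
      (t + N q′ y) + (N q y + N u q)        ∎)

  reverseTriangle : ∀ {u q} → HasJoin u u → Star AllowedStep u q → ReverseTriangle u q
  reverseTriangle {u} has = go (reverseTriangle-refl has)
    where
    go : ∀ {q q′} → ReverseTriangle u q → Star AllowedStep q q′ → ReverseTriangle u q′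
    go rt ε              = rt
    go rt (step ◅ steps) = go (reverseTriangle-step has step rt) steps

  -- Walks of allowed edges, and the equivalence relation.

  factorConnected⇒walk : ∀ {u v} → FactorConnected Γ u v → Star AllowedStep u v
  factorConnected⇒walk {u} {v} (P , (((_ , connected) , _) , ends) , allowed) =
    gmap id (λ (e , e∈ , joins) → e , allowed e e∈ , joins)
      (connected u v (proj₁ (from (ends u) (inj₁ refl))) (proj₁ (from (ends v) (inj₂ refl))))
    where open Equivalence

  -- Walks can be concatenated and reversed directly, paths cannot be concatenated; so symmetry and
  -- transitivity work with walks and return to a path here.
  walk⇒factorConnected : ∀ {u v} → Star AllowedStep u v → FactorConnected Γ u v
  walk⇒factorConnected walk with simplify walk
  ... | _ , _ , path = subgraph path , isPathBetween path , good path

  reverseWalk : ∀ {u v} → Star AllowedStep u v → Star AllowedStep v u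
  reverseWalk = reverse λ (e , allowed , joins) → e , allowed , swap joins

  -- Distinctness matters: for `u ≡ v` the union is a singleton, while the sum modulo two is empty.
  ν≡N : ∀ {u v} → u ≢ v → ν G (T △ (⁅ u ⁆ ∪ ⁅ v ⁆)) ≡ N u v
  ν≡N {u} {v} u≢v = cong (ν G) (trans (△≡⊕ T _) (cong (T ⊕_) (⁅⁆∪⁅⁆≡⊕ u v u≢v)))

  -- A walk between distinct vertices has a first edge, and its being allowed comes with a minimum
  -- join of `T`.
  hasJoin : ∀ {u v} → u ≢ v → Star AllowedStep u v → ∀ x → HasJoin x x
  hasJoin u≢v ε x = contradiction refl u≢v
  hasJoin u≢v ((e , (F , F-min , _) , _) ◅ _) x = F , minimumJoin x F-min

  similar-sym : ∀ {u v} → Similar Γ u v → Similar Γ v u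
  similar-sym (inj₁ u≡v) = inj₁ (sym u≡v)
  similar-sym {u} {v} (inj₂ (u≢v , fc , ν≡)) = inj₂
    ( u≢v ∘ sym
    , walk⇒factorConnected (reverseWalk (factorConnected⇒walk fc))
    , trans (cong (λ S → ν G (T △ S)) (∪-comm ⁅ v ⁆ ⁅ u ⁆)) ν≡ )

  similar-trans : ∀ {u v w} → Similar Γ u v → Similar Γ v w → Similar Γ u w
  similar-trans (inj₁ refl) v~w = v~w
  similar-trans u~v@(inj₂ _) (inj₁ refl) = u~v
  -- The case `u ≡ w` falls under the first alternative of `Similar`. Otherwise the first similarity
  -- is reversed, because the inequality rooted at `v` involves λ(v, u).
  similar-trans {u} {v} {w} u~v@(inj₂ (u≢v , fc-uv , _)) (inj₂ (v≢w , fc-vw , ν-vw)) with u ≟ w | similar-sym u~v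
  ... | yes u≡w | _ = inj₁ u≡w
  ... | no u≢w  | inj₁ v≡u = contradiction (sym v≡u) u≢v
  ... | no u≢w  | inj₂ (v≢u , fc-vu , ν-vu) =
    inj₂ (u≢w , walk⇒factorConnected walk-uw , trans (ν≡N u≢w) (≤-antisym N≤t t≤N))
    where
    open ≤-Reasoning
    t = ν G T
    walk-uw = factorConnected⇒walk fc-uv ◅◅ factorConnected⇒walk fc-vw
    has     = hasJoin u≢w walk-uw

    rooted-u : ReverseTriangle u w
    rooted-u = reverseTriangle (has u) walk-uw

    rooted-v : ReverseTriangle v u
    rooted-v = reverseTriangle (has v) (factorConnected⇒walk fc-vu)

    has-vw : HasJoin v w
    has-vw = proj₁ (reverseTriangle (has v) (factorConnected⇒walk fc-vw))

    t≤N : t ≤ N u w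
    t≤N = +-cancelˡ-≤ t _ _ (begin
      t + t          ≡⟨ cong₂ _+_ (trans (sym (ν≡N v≢u)) ν-vu) (trans (sym (ν≡N v≢w)) ν-vw) ⟨
      N v u + N v w  ≤⟨ proj₂ rooted-v w has-vw ⟩
      t + N u w      ∎)

    N≤t : N u w ≤ t
    N≤t = ≮⇒≥ λ t<N → <⇒≱ (+-mono-< t<N t<N) (begin
      N u w + N u w  ≤⟨ proj₂ rooted-u w (proj₁ rooted-u) ⟩
      t + N w w      ≡⟨ cong (t +_) (N-diagonal w) ⟩
      t + t          ∎)

theorem6p6 : (Γ : Graft) → IsEquivalence (Similar Γ)
theorem6p6 Γ = record
  { refl  = inj₁ refl
  ; sym   = similar-sym Γ
  ; trans = similar-trans Γ
  }
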